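{- Let $r\ge 1$ and let $b_1,b_2,\dots,b_r$ be integers. Then there exists an $r\times r$ matrix $f$ with integer entries such that $b_i=\operatorname{Tr}(f^i)$ for all $1\le i\le r$ if and only if the following condition holds for every integer $n$ with $1\le n\le r$: whenever $p$ is a prime, $k\ge 1$ and $m\ge 1$ are integers, $n=mp^k$ and $\gcd(m,p)=1$, one has $$b_n\equiv b_{n/p}\pmod{p^k}.$$
   Context: $\operatorname{Tr}$ denotes the trace of a square matrix. -}

module Defs where

open import Data.Bool.Base using (if_then_else_)
open import Data.Fin.Properties using (_≟_)
open import Data.Integer.Base using (ℤ; 0ℤ; 1ℤ; +_; _*_; _-_)
open import Data.Integer.Divisibility.Signed using (_∣_)
open import Data.Integer.Properties using (+-*-semiring)
open import Data.Nat.Base using (ℕ; zero; suc)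
open import Data.Vec.Functional using (Vector)
open import Relation.Nullary.Decidable using (does)

open import Algebra.Properties.Semiring.Sum +-*-semiring using (sum)

SquareMatrix : ℕ → Set
SquareMatrix n = Vector (Vector ℤ n) n

identity : ∀ {n} → SquareMatrix n
identity i j = if does (i ≟ j) then 1ℤ else 0ℤ

infixl 7 _·_
infixr 8 _^ᴹ_

_·_ : ∀ {n} → SquareMatrix n → SquareMatrix n → SquareMatrix n
(A · B) i j = sum λ k → A i k * B k j

_^ᴹ_ : ∀ {n} → SquareMatrix n → ℕ → SquareMatrix n
A ^ᴹ zero  = identity
A ^ᴹ suc k = A · A ^ᴹ k

Tr : ∀ {n} → SquareMatrix n → ℤ
Tr A = sum λ i → A i i

infix 4 _≡_[mod_]

_≡_[mod_] : ℤ → ℤ → ℕ → Set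
a ≡ b [mod n ] = + n ∣ a - b

-- Call T a logarithmic derivative if T = − X q′/q for some q in 1 + X ℤ[[X]].
-- Deleting a vertex from a matrix A changes the series of its traces by the
-- logarithmic derivative of q = 1 − Σ (weights of first returns to the vertex),
-- so trace series are logarithmic derivatives; for companion matrices q can be
-- prescribed up to degree r. The series δ d = d Xᵈ / (1 − Xᵈ), which comes from
-- q = 1 − Xᵈ, satisfies the congruences. If T is a logarithmic derivative, or
-- satisfies the congruences, and its first nonzero coefficient is the N-th, then
-- N divides it, and a multiple of δ N can be subtracted from T. Hence both kinds
-- of series agree, up to any degree, with integral combinations of the δ d.

module Submission where

-- Formal power series with integer coefficients

module PowerSeries where

  open import Algebra.Bundles using (CommutativeRing)
  open import Data.Integer.Base hiding (suc; _≤_)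
  open import Data.Integer.Properties
  open import Data.Integer.Tactic.RingSolver using (solve-∀)
  open import Data.Nat.Base as ℕ using (ℕ; zero; suc; z≤n; s≤s; _≤_)
  import Data.Nat.Properties as ℕₚ
  open import Data.Product using (_,_)
  open import Function.Base using (_∘_)
  open import Level using (0ℓ)
  open import Relation.Binary.PropositionalEquality
  open ≡-Reasoning

  Series : Set
  Series = ℕ → ℤ

  infix 4 _≗[_]_
  infixl 7 _⊛_

  _≗[_]_ : Series → ℕ → Series → Set
  f ≗[ N ] g = ∀ i → i ≤ N → f i ≡ g i

  -- The Cauchy product, by recursion on the degree: the constant coefficient of the left factor is
  -- split off and the rest of that factor is shifted down.
  _⊛_ : Series → Series → Series
  (f ⊛ g) zero    = f 0 * g 0
  (f ⊛ g) (suc n) = f 0 * g (suc n) + (f ∘ suc ⊛ g) n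

  -- The Euler operator X d/dX.
  θ : Series → Series
  θ f n = + n * f n

  X^ : ℕ → Series
  X^ zero    zero    = 1ℤ
  X^ zero    (suc n) = 0ℤ
  X^ (suc d) zero    = 0ℤ
  X^ (suc d) (suc n) = X^ d n

  -- Coefficient N of a product involves no coefficient beyond N, so products can be compared when
  -- the factors are known only up to some degree.
  ⊛-cong-≤ : ∀ {f f′ g g′} N → f ≗[ N ] f′ → g ≗[ N ] g′ → (f ⊛ g) N ≡ (f′ ⊛ g′) N
  ⊛-cong-≤ zero    p q = cong₂ _*_ (p 0 z≤n) (q 0 z≤n)
  ⊛-cong-≤ (suc N) p q = cong₂ _+_
    (cong₂ _*_ (p 0 z≤n) (q (suc N) (s≤s ℕₚ.≤-refl)))
    (⊛-cong-≤ N (λ i i≤N → p (suc i) (s≤s i≤N)) (λ i i≤N → q i (ℕₚ.m≤n⇒m≤1+n i≤N)))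

  ⊛-cong : ∀ {f f′ g g′} → f ≗ f′ → g ≗ g′ → f ⊛ g ≗ f′ ⊛ g′
  ⊛-cong p q n = ⊛-cong-≤ n (λ i _ → p i) (λ i _ → q i)

  ⊛-local : ∀ {f f′ g g′ N} → f ≗[ N ] f′ → g ≗[ N ] g′ → f ⊛ g ≗[ N ] f′ ⊛ g′
  ⊛-local p q i i≤N = ⊛-cong-≤ i (λ j j≤i → p j (ℕₚ.≤-trans j≤i i≤N)) (λ j j≤i → q j (ℕₚ.≤-trans j≤i i≤N))

  ⊛-scaleˡ : ∀ c f g → (λ i → c * f i) ⊛ g ≗ (λ i → c * (f ⊛ g) i)
  ⊛-scaleˡ c f g zero    = *-assoc c (f 0) (g 0)
  ⊛-scaleˡ c f g (suc n) = begin
    c * f 0 * g (suc n) + ((λ i → c * f (suc i)) ⊛ g) n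
      ≡⟨ cong₂ _+_ (*-assoc c (f 0) _) (⊛-scaleˡ c (f ∘ suc) g n) ⟩
    c * (f 0 * g (suc n)) + c * (f ∘ suc ⊛ g) n
      ≡⟨ *-distribˡ-+ c _ _ ⟨
    c * (f 0 * g (suc n) + (f ∘ suc ⊛ g) n) ∎

  ⊛-distribʳ : ∀ h f g → (λ i → f i + g i) ⊛ h ≗ (λ i → (f ⊛ h) i + (g ⊛ h) i)
  ⊛-distribʳ h f g zero    = *-distribʳ-+ (h 0) (f 0) (g 0)
  ⊛-distribʳ h f g (suc n) = begin
    (f 0 + g 0) * h (suc n) + ((λ i → f (suc i) + g (suc i)) ⊛ h) n
      ≡⟨ cong₂ _+_ (refl {x = (f 0 + g 0) * h (suc n)}) (⊛-distribʳ h (f ∘ suc) (g ∘ suc) n) ⟩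
    (f 0 + g 0) * h (suc n) + ((f ∘ suc ⊛ h) n + (g ∘ suc ⊛ h) n)
      ≡⟨ lemma (f 0) (g 0) (h (suc n)) _ _ ⟩
    f 0 * h (suc n) + (f ∘ suc ⊛ h) n + (g 0 * h (suc n) + (g ∘ suc ⊛ h) n) ∎
    where
    lemma : ∀ a b c x y → (a + b) * c + (x + y) ≡ a * c + x + (b * c + y)
    lemma = solve-∀

  -- The mirror image of the defining recursion, with the constant coefficient of the right factor
  -- split off. Commutativity follows by comparing the two.
  ⊛-suc : ∀ f g n → (f ⊛ g) (suc n) ≡ (f ⊛ g ∘ suc) n + f (suc n) * g 0
  ⊛-suc f g zero    = refl
  ⊛-suc f g (suc n) = begin
    f 0 * g (2 ℕ.+ n) + (f ∘ suc ⊛ g) (suc n)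
      ≡⟨ cong₂ _+_ (refl {x = f 0 * g (2 ℕ.+ n)}) (⊛-suc (f ∘ suc) g n) ⟩
    f 0 * g (2 ℕ.+ n) + ((f ∘ suc ⊛ g ∘ suc) n + f (2 ℕ.+ n) * g 0)
      ≡⟨ +-assoc (f 0 * g (2 ℕ.+ n)) _ _ ⟨
    f 0 * g (2 ℕ.+ n) + (f ∘ suc ⊛ g ∘ suc) n + f (2 ℕ.+ n) * g 0 ∎

  ⊛-comm : ∀ f g → f ⊛ g ≗ g ⊛ f
  ⊛-comm f g zero    = *-comm (f 0) (g 0)
  ⊛-comm f g (suc n) = begin
    f 0 * g (suc n) + (f ∘ suc ⊛ g) n  ≡⟨ cong₂ _+_ (*-comm (f 0) _) (⊛-comm (f ∘ suc) g n) ⟩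
    g (suc n) * f 0 + (g ⊛ f ∘ suc) n  ≡⟨ +-comm (g (suc n) * f 0) _ ⟩
    (g ⊛ f ∘ suc) n + g (suc n) * f 0  ≡⟨ ⊛-suc g f n ⟨
    (g ⊛ f) (suc n)                    ∎

  ⊛-assoc : ∀ f g h → (f ⊛ g) ⊛ h ≗ f ⊛ (g ⊛ h)
  ⊛-assoc f g h zero    = *-assoc (f 0) (g 0) (h 0)
  ⊛-assoc f g h (suc n) = begin
    f 0 * g 0 * h (suc n) + ((λ i → f 0 * g (suc i) + (f ∘ suc ⊛ g) i) ⊛ h) n
      ≡⟨ cong₂ _+_ (refl {x = f 0 * g 0 * h (suc n)})
           (⊛-distribʳ h (λ i → f 0 * g (suc i)) (f ∘ suc ⊛ g) n) ⟩
    f 0 * g 0 * h (suc n) + (((λ i → f 0 * g (suc i)) ⊛ h) n + ((f ∘ suc ⊛ g) ⊛ h) n)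
      ≡⟨ cong₂ _+_ (refl {x = f 0 * g 0 * h (suc n)})
           (cong₂ _+_ (⊛-scaleˡ (f 0) (g ∘ suc) h n) (⊛-assoc (f ∘ suc) g h n)) ⟩
    f 0 * g 0 * h (suc n) + (f 0 * (g ∘ suc ⊛ h) n + (f ∘ suc ⊛ (g ⊛ h)) n)
      ≡⟨ lemma (f 0) (g 0) (h (suc n)) _ _ ⟩
    f 0 * (g 0 * h (suc n) + (g ∘ suc ⊛ h) n) + (f ∘ suc ⊛ (g ⊛ h)) n ∎
    where
    lemma : ∀ a b c x y → a * b * c + (a * x + y) ≡ a * (b * c + x) + y
    lemma = solve-∀

  zero-⊛ : ∀ f n → ((λ _ → 0ℤ) ⊛ f) n ≡ 0ℤ
  zero-⊛ f zero    = refl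
  zero-⊛ f (suc n) = trans (+-identityˡ _) (zero-⊛ f n)

  ⊛-identityˡ : ∀ f → X^ 0 ⊛ f ≗ f
  ⊛-identityˡ f zero    = *-identityˡ (f 0)
  ⊛-identityˡ f (suc n) = begin
    1ℤ * f (suc n) + ((λ _ → 0ℤ) ⊛ f) n  ≡⟨ cong₂ _+_ (*-identityˡ (f (suc n))) (zero-⊛ f n) ⟩
    f (suc n) + 0ℤ                       ≡⟨ +-identityʳ _ ⟩
    f (suc n)                            ∎

  -- The Leibniz rule, by induction on the degree. Shifting `θ f` gives `f′` + `θ f′`, and the extra
  -- `f′ ⊛ g` accounts for the factor n + 1 in place of n.
  θ-⊛ : ∀ f g → θ (f ⊛ g) ≗ λ n → (θ f ⊛ g) n + (f ⊛ θ g) n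
  θ-⊛ f g zero    = lemma (f 0) (g 0)
    where
    lemma : ∀ a b → 0ℤ * (a * b) ≡ 0ℤ * a * b + a * (0ℤ * b)
    lemma = solve-∀
  θ-⊛ f g (suc n) = begin
    + suc n * (f 0 * g (suc n) + (f′ ⊛ g) n)
      ≡⟨ cong (_* (f 0 * g (suc n) + (f′ ⊛ g) n)) (pos-+ 1 n) ⟩
    (1ℤ + + n) * (f 0 * g (suc n) + (f′ ⊛ g) n)
      ≡⟨ split (+ n) (f 0) (g (suc n)) _ ⟩
    f 0 * ((1ℤ + + n) * g (suc n)) + + n * (f′ ⊛ g) n + (f′ ⊛ g) n
      ≡⟨ cong (λ z → f 0 * ((1ℤ + + n) * g (suc n)) + z + (f′ ⊛ g) n) (θ-⊛ f′ g n) ⟩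
    f 0 * ((1ℤ + + n) * g (suc n)) + ((θ f′ ⊛ g) n + (f′ ⊛ θ g) n) + (f′ ⊛ g) n
      ≡⟨ regroup (f 0) ((1ℤ + + n) * g (suc n)) (g (suc n)) _ _ _ ⟩
    0ℤ * f 0 * g (suc n) + ((f′ ⊛ g) n + (θ f′ ⊛ g) n) + (f 0 * ((1ℤ + + n) * g (suc n)) + (f′ ⊛ θ g) n)
      ≡⟨ cong₂ (λ y z → 0ℤ * f 0 * g (suc n) + y + (f 0 * (z * g (suc n)) + (f′ ⊛ θ g) n))
           (trans (⊛-cong suc-θ (λ _ → refl) n) (⊛-distribʳ g f′ (θ f′) n)) (pos-+ 1 n) ⟨
    (θ f ⊛ g) (suc n) + (f ⊛ θ g) (suc n) ∎
    where
    f′ = f ∘ suc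
    split : ∀ m a b x → (1ℤ + m) * (a * b + x) ≡ a * ((1ℤ + m) * b) + m * x + x
    split = solve-∀
    regroup : ∀ a b c x y z → a * b + (x + y) + z ≡ 0ℤ * a * c + (z + x) + (a * b + y)
    regroup = solve-∀
    suc-θ : θ f ∘ suc ≗ λ i → f′ i + θ f′ i
    suc-θ i = trans (cong (_* f′ i) (pos-+ 1 i)) (lemma (+ i) (f′ i))
      where
      lemma : ∀ m a → (1ℤ + m) * a ≡ a + m * a
      lemma = solve-∀

  X^-⊛-< : ∀ d f {n} → n ℕ.< d → (X^ d ⊛ f) n ≡ 0ℤ
  X^-⊛-< (suc d) f {zero}  _         = refl
  X^-⊛-< (suc d) f {suc n} (s≤s n<d) = trans (+-identityˡ _) (X^-⊛-< d f n<d)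

  X^-⊛-+ : ∀ d f n → (X^ d ⊛ f) (d ℕ.+ n) ≡ f n
  X^-⊛-+ zero    f n = ⊛-identityˡ f n
  X^-⊛-+ (suc d) f n = trans (+-identityˡ _) (X^-⊛-+ d f n)

  seriesRing : CommutativeRing 0ℓ 0ℓ
  seriesRing = record
    { Carrier = Series
    ; _≈_ = _≗_
    ; _+_ = λ f g n → f n + g n
    ; _*_ = _⊛_
    ; -_  = λ f n → - f n
    ; 0#  = λ _ → 0ℤ
    ; 1#  = X^ 0
    ; isCommutativeRing = record
      { isRing = record
        { +-isAbelianGroup = record
          { isGroup = record
            { isMonoid = record
              { isSemigroup = record
                { isMagma = record
                  { isEquivalence = record
                    { refl  = λ _ → refl
                    ; sym   = λ p n → sym (p n)
                    ; trans = λ p q n → trans (p n) (q n)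
                    }
                  ; ∙-cong = λ p q n → cong₂ _+_ (p n) (q n)
                  }
                ; assoc = λ f g h n → +-assoc (f n) (g n) (h n)
                }
              ; identity = (λ f n → +-identityˡ (f n)) , λ f n → +-identityʳ (f n)
              }
            ; inverse = (λ f n → +-inverseˡ (f n)) , λ f n → +-inverseʳ (f n)
            ; ⁻¹-cong = λ p n → cong -_ (p n)
            }
          ; comm = λ f g n → +-comm (f n) (g n)
          }
        ; *-cong = ⊛-cong
        ; *-assoc = ⊛-assoc
        ; *-identity = ⊛-identityˡ , λ f n → trans (⊛-comm f (X^ 0) n) (⊛-identityˡ f n)
        ; distrib =
            (λ f g h n → trans (⊛-comm f _ n)
              (trans (⊛-distribʳ f g h n) (cong₂ _+_ (⊛-comm g f n) (⊛-comm h f n))))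
          , ⊛-distribʳ
        }
      ; *-comm = ⊛-comm
      }
    }

module LogarithmicDerivatives where

  open PowerSeries
  open import Algebra.Bundles using (module CommutativeRing)
  open CommutativeRing seriesRing
  open import Algebra.Properties.CommutativeSemigroup *-commutativeSemigroup using (interchange; x∙yz≈y∙xz)
  open import Algebra.Properties.Group +-group using (inverseˡ-unique)
  open import Algebra.Properties.Ring ring using (-‿distribˡ-*; -‿distribʳ-*)
  open import Data.Integer.Base as ℤ using (ℤ; +_; -[1+_]; 0ℤ; 1ℤ)
  import Data.Integer.Properties as ℤₚ
  open import Data.Integer.Divisibility.Signed using (divides) renaming (_∣_ to _∣ℤ_)
  open import Data.Nat.Base as ℕ using (ℕ; zero; suc; s≤s; _<_)
  import Data.Nat.Properties as ℕₚ
  open import Data.Nat.Divisibility using (_∣_; _∤_; _∣?_; >⇒∤; ∣m∣n⇒∣m+n; ∣m+n∣m⇒∣n; ∣-refl)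
  open import Data.Bool.Base using (if_then_else_; true; false)
  open import Data.Product using (∃; _,_)
  open import Function.Base using (_∘_)
  open import Function.Bundles using (mk⇔)
  open import Relation.Nullary.Decidable using (does; yes; no; does-⇔; dec-false; dec-true)
  open import Relation.Binary.PropositionalEquality as ≡ using (_≡_; cong; cong₂)

  -- T = −X q′/q. The inverse u of q is kept so that −T is again such
  -- a series, namely for u in place of q.
  record LogDerivative (q T : Series) : Set where
    field
      u       : Series
      u₀≡1    : u 0 ≡ 1ℤ
      q₀≡1    : q 0 ≡ 1ℤ
      inverse : u * q ≈ 1#
      formula : T ≈ θ u * q

  open LogDerivative

  θ-1 : θ 1# ≈ 0#
  θ-1 zero    = ≡.refl
  θ-1 (suc n) = ℤₚ.*-zeroʳ (+ suc n)

  θ-cong : ∀ {f g} → f ≈ g → θ f ≈ θ g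
  θ-cong p n = cong (+ n ℤ.*_) (p n)

  -- The Leibniz rule applied to the constant u q. With u = 1/q the right side is -X q′/q, which
  -- justifies `formula` in `LogDerivative`.
  θ-inverse : ∀ u q → u * q ≈ 1# → θ u * q ≈ - (θ q * u)
  θ-inverse u q uq≈1 = inverseˡ-unique _ _ (begin
    θ u * q + θ q * u  ≈⟨ +-congˡ {θ u * q} (*-comm (θ q) u) ⟩
    θ u * q + u * θ q  ≈⟨ θ-⊛ u q ⟨
    θ (u * q)          ≈⟨ θ-cong uq≈1 ⟩
    θ 1#               ≈⟨ θ-1 ⟩
    0#                 ∎)
    where open import Relation.Binary.Reasoning.Setoid setoid

  logDerivative-cong : ∀ {q T T′} → T ≈ T′ → LogDerivative q T → LogDerivative q T′
  logDerivative-cong T≈T′ L = record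
    { u = u L ; u₀≡1 = u₀≡1 L ; q₀≡1 = q₀≡1 L ; inverse = inverse L
    ; formula = trans (sym T≈T′) (formula L) }

  logDerivative-1 : LogDerivative 1# 0#
  logDerivative-1 = record
    { u = 1# ; u₀≡1 = ≡.refl ; q₀≡1 = ≡.refl ; inverse = *-identityˡ 1#
    ; formula = sym (trans (*-congʳ θ-1) (zeroˡ 1#)) }

  -- The Leibniz rule for the product of the inverses: in each of its two terms one pair of inverse
  -- factors cancels, which leaves `T` and `T′`.
  logDerivative-* : ∀ {q q′ T T′} → LogDerivative q T → LogDerivative q′ T′ →
                    LogDerivative (q * q′) (T + T′)
  logDerivative-* {q} {q′} {T} {T′} L L′ = record
    { u = v * v′ ; u₀≡1 = cong₂ ℤ._*_ (u₀≡1 L) (u₀≡1 L′) ; q₀≡1 = cong₂ ℤ._*_ (q₀≡1 L) (q₀≡1 L′)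
    ; inverse = begin
        (v * v′) * (q * q′)  ≈⟨ interchange v v′ q q′ ⟩
        (v * q) * (v′ * q′)  ≈⟨ *-cong (inverse L) (inverse L′) ⟩
        1# * 1#              ≈⟨ *-identityˡ 1# ⟩
        1#                   ∎
    ; formula = sym (begin
        θ (v * v′) * (q * q′)
          ≈⟨ *-congʳ (θ-⊛ v v′) ⟩
        (θ v * v′ + v * θ v′) * (q * q′)
          ≈⟨ distribʳ (q * q′) _ _ ⟩
        (θ v * v′) * (q * q′) + (v * θ v′) * (q * q′)
          ≈⟨ +-cong (interchange (θ v) v′ q q′) (interchange v (θ v′) q q′) ⟩
        (θ v * q) * (v′ * q′) + (v * q) * (θ v′ * q′)
          ≈⟨ +-cong (*-cong (sym (formula L)) (inverse L′)) (*-cong (inverse L) (sym (formula L′))) ⟩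
        T * 1# + 1# * T′
          ≈⟨ +-cong (*-identityʳ T) (*-identityˡ T′) ⟩
        T + T′ ∎)
    }
    where
    open import Relation.Binary.Reasoning.Setoid setoid
    v  = u L
    v′ = u L′

  logDerivative-⁻¹ : ∀ {q T} (L : LogDerivative q T) → LogDerivative (u L) (- T)
  logDerivative-⁻¹ {q} {T} L = record
    { u = q ; u₀≡1 = q₀≡1 L ; q₀≡1 = u₀≡1 L ; inverse = qu≈1
    ; formula = trans (-‿cong (formula L)) (sym (θ-inverse q (u L) qu≈1)) }
    where
    qu≈1 : q * u L ≈ 1#
    qu≈1 = trans (*-comm q (u L)) (inverse L)

  -- Newton's identities: in degree n they read T n + q 1 T (n - 1) + ... = - n q n.
  newton : ∀ {q T} → LogDerivative q T → q * T ≈ - θ q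
  newton {q} {T} L = begin
    q * T                 ≈⟨ *-congˡ (trans (formula L) (θ-inverse v q (inverse L))) ⟩
    q * - (θ q * v)       ≈⟨ -‿distribʳ-* q (θ q * v) ⟨
    - (q * (θ q * v))     ≈⟨ -‿cong (trans (x∙yz≈y∙xz q (θ q) v) (*-congˡ (trans (*-comm q v) (inverse L)))) ⟩
    - (θ q * 1#)          ≈⟨ -‿cong (*-identityʳ (θ q)) ⟩
    - θ q                 ∎
    where
    open import Relation.Binary.Reasoning.Setoid setoid
    v = u L

  -- By `newton`, q up to degree N determines the product q T up to degree N. Multiplication by the
  -- inverse `v` of q then recovers T.
  logDerivative-local : ∀ {q q′ T T′} N → LogDerivative q T → LogDerivative q′ T′ →
                        q ≗[ N ] q′ → T ≗[ N ] T′
  logDerivative-local {q} {q′} {T} {T′} N L L′ q≗q′ i i≤N = begin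
    T i               ≡⟨ cancel T i ⟩
    (v * (q * T)) i   ≡⟨ ⊛-local {f = v} (λ _ _ → ≡.refl) same i i≤N ⟩
    (v * (q * T′)) i  ≡⟨ cancel T′ i ⟨
    T′ i              ∎
    where
    open ≡.≡-Reasoning
    v = u L
    cancel : ∀ f → f ≈ v * (q * f)
    cancel f = sym (trans (sym (*-assoc v q f)) (trans (*-congʳ (inverse L)) (*-identityˡ f)))
    same : q * T ≗[ N ] q * T′
    same j j≤N = begin
      (q * T) j          ≡⟨ newton L j ⟩
      ℤ.- (+ j ℤ.* q j)  ≡⟨ cong (λ z → ℤ.- (+ j ℤ.* z)) (q≗q′ j j≤N) ⟩
      ℤ.- (+ j ℤ.* q′ j) ≡⟨ newton L′ j ⟨
      (q′ * T′) j        ≡⟨ ⊛-local {g = T′} q≗q′ (λ _ _ → ≡.refl) j j≤N ⟨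
      (q * T′) j         ∎

  ⊛-leading : ∀ f g N → (∀ i → i < N → g i ≡ 0ℤ) → (f * g) N ≡ f 0 ℤ.* g N
  ⊛-leading f g zero    _  = ≡.refl
  ⊛-leading f g (suc N) g≡0 = begin
    f 0 ℤ.* g (suc N) ℤ.+ ((f ∘ suc) * g) N
      ≡⟨ cong₂ ℤ._+_ (≡.refl {x = f 0 ℤ.* g (suc N)})
           (⊛-local {f = f ∘ suc} {g′ = 0#} {N = N} (λ _ _ → ≡.refl) (λ i i≤N → g≡0 i (s≤s i≤N)) N ℕₚ.≤-refl) ⟩
    f 0 ℤ.* g (suc N) ℤ.+ ((f ∘ suc) * 0#) N
      ≡⟨ cong₂ ℤ._+_ (≡.refl {x = f 0 ℤ.* g (suc N)}) (zeroʳ (f ∘ suc) N) ⟩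
    f 0 ℤ.* g (suc N) ℤ.+ 0ℤ
      ≡⟨ ℤₚ.+-identityʳ _ ⟩
    f 0 ℤ.* g (suc N) ∎
    where open ≡.≡-Reasoning

  -- When T starts in degree N, coefficient N of q T is T N itself, and `newton` evaluates it as - N
  -- q N.
  logDerivative-leading : ∀ {q T} → LogDerivative q T → ∀ N → (∀ i → i < N → T i ≡ 0ℤ) → + N ∣ℤ T N
  logDerivative-leading {q} {T} L N T≡0 = divides (ℤ.- q N) (begin
    T N                  ≡⟨ ℤₚ.*-identityˡ (T N) ⟨
    1ℤ ℤ.* T N           ≡⟨ cong (ℤ._* T N) (q₀≡1 L) ⟨
    q 0 ℤ.* T N          ≡⟨ ⊛-leading q T N T≡0 ⟨
    (q * T) N            ≡⟨ newton L N ⟩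
    ℤ.- (+ N ℤ.* q N)    ≡⟨ ℤₚ.neg-distribʳ-* (+ N) (q N) ⟩
    + N ℤ.* ℤ.- q N      ≡⟨ ℤₚ.*-comm (+ N) _ ⟩
    ℤ.- q N ℤ.* + N      ∎)
    where open ≡.≡-Reasoning

  -- δ d is the series of d Xᵈ / (1 − Xᵈ), the value of −X q′/q at q = 1 − Xᵈ.
  δ : ℕ → Series
  δ d zero    = 0ℤ
  δ d (suc n) = if does (d ∣? suc n) then + d else 0ℤ

  δ-∣ : ∀ {d} n .{{_ : ℕ.NonZero n}} → d ∣ n → δ d n ≡ + d
  δ-∣ {d} n@(suc _) d∣n = cong (if_then + d else 0ℤ) (dec-true (d ∣? n) d∣n)

  δ-∤ : ∀ {d} n → d ∤ n → δ d n ≡ 0ℤ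
  δ-∤ zero          _   = ≡.refl
  δ-∤ {d} n@(suc _) d∤n = cong (if_then + d else 0ℤ) (dec-false (d ∣? n) d∤n)

  δ-< : ∀ {d} n → n < d → δ d n ≡ 0ℤ
  δ-< zero      _   = ≡.refl
  δ-< n@(suc _) n<d = δ-∤ n (>⇒∤ n<d)

  -- The inverse of q is the geometric series G in Xᵈ, characterised by G = 1 + Xᵈ G. Since - `θ q`
  -- is d Xᵈ, multiplying it by G gives δ d.
  logDerivative-δ : ∀ e → LogDerivative (1# + - X^ (suc e)) (δ (suc e))
  logDerivative-δ e = record
    { u = geometric ; u₀≡1 = ≡.refl ; q₀≡1 = ≡.refl ; inverse = inv
    ; formula = sym (begin
        θ geometric * q                      ≈⟨ θ-inverse geometric q inv ⟩
        - (θ q * geometric)                  ≈⟨ -‿distribˡ-* (θ q) geometric ⟩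
        - θ q * geometric                    ≈⟨ *-congʳ θq ⟩
        (λ n → + d ℤ.* X^ d n) * geometric   ≈⟨ ⊛-scaleˡ (+ d) (X^ d) geometric ⟩
        (λ n → + d ℤ.* (X^ d * geometric) n) ≈⟨ δ-formula ⟩
        δ d                                  ∎)
    }
    where
    open import Relation.Binary.Reasoning.Setoid setoid
    d = suc e
    q = 1# + - X^ d
    geometric : Series
    geometric n = if does (d ∣? n) then 1ℤ else 0ℤ

    -- Below degree d the product Xᵈ G vanishes; in degree d + k it has coefficient k of G.
    data Compared : ℕ → Set where
      below : ∀ {n} → n < d → Compared n
      above : ∀ k → Compared (d ℕ.+ k)

    compare : ∀ n → Compared n
    compare n with n ℕₚ.<? d
    ... | yes n<d = below n<d
    ... | no  n≮d = ≡.subst Compared (ℕₚ.m+[n∸m]≡n (ℕₚ.≮⇒≥ n≮d)) (above _)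

    shift-∣ : ∀ k → does (d ∣? (d ℕ.+ k)) ≡ does (d ∣? k)
    shift-∣ k = does-⇔ (mk⇔ (λ d∣d+k → ∣m+n∣m⇒∣n d∣d+k ∣-refl) (∣m∣n⇒∣m+n ∣-refl)) (d ∣? (d ℕ.+ k)) (d ∣? k)

    geometric-formula : geometric ≈ 1# + X^ d * geometric
    geometric-formula n with compare n
    geometric-formula zero | below _ = ≡.refl
    geometric-formula (suc n) | below n<d = ≡.trans
      (cong (if_then 1ℤ else 0ℤ) (dec-false (d ∣? suc n) (>⇒∤ n<d)))
      (≡.sym (≡.trans (ℤₚ.+-identityˡ _) (X^-⊛-< d geometric n<d)))
    geometric-formula .(d ℕ.+ k) | above k = ≡.trans
      (cong (if_then 1ℤ else 0ℤ) (shift-∣ k))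
      (≡.sym (≡.trans (ℤₚ.+-identityˡ _) (X^-⊛-+ d geometric k)))

    δ-formula : (λ n → + d ℤ.* (X^ d * geometric) n) ≈ δ d
    δ-formula n with compare n
    ... | below n<d = ≡.trans (cong (+ d ℤ.*_) (X^-⊛-< d geometric n<d))
      (≡.trans (ℤₚ.*-zeroʳ (+ d)) (≡.sym (δ-< n n<d)))
    ... | above k   = ≡.trans (cong (+ d ℤ.*_) (X^-⊛-+ d geometric k))
      (≡.trans (scale (does (d ∣? k))) (cong (if_then + d else 0ℤ) (≡.sym (shift-∣ k))))
      where
      scale : ∀ b → + d ℤ.* (if b then 1ℤ else 0ℤ) ≡ (if b then + d else 0ℤ)
      scale = λ { true → ℤₚ.*-identityʳ (+ d) ; false → ℤₚ.*-zeroʳ (+ d) }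

    inv : geometric * q ≈ 1#
    inv = begin
      geometric * (1# + - X^ d)
        ≈⟨ distribˡ geometric 1# (- X^ d) ⟩
      geometric * 1# + geometric * - X^ d
        ≈⟨ +-cong (*-identityʳ geometric) (sym (-‿distribʳ-* geometric (X^ d))) ⟩
      geometric + - (geometric * X^ d)
        ≈⟨ +-cong geometric-formula (-‿cong (*-comm geometric (X^ d))) ⟩
      1# + X^ d * geometric + - (X^ d * geometric)
        ≈⟨ +-assoc 1# (X^ d * geometric) _ ⟩
      1# + (X^ d * geometric + - (X^ d * geometric))
        ≈⟨ +-congˡ {1#} (-‿inverseʳ (X^ d * geometric)) ⟩
      1# + 0#
        ≈⟨ +-identityʳ 1# ⟩
      1# ∎

    -- Monomials are eigenvectors of the Euler operator: only i = d gives a nonzero coefficient.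
    θX : ∀ d i → + i ℤ.* X^ d i ≡ + d ℤ.* X^ d i
    θX zero    zero    = ≡.refl
    θX zero    (suc i) = ℤₚ.*-zeroʳ (+ suc i)
    θX (suc d) zero    = ≡.sym (ℤₚ.*-zeroʳ (+ suc d))
    θX (suc d) (suc i) = ≡.trans (step i) (≡.trans (cong₂ ℤ._+_ (≡.refl {x = X^ d i}) (θX d i)) (≡.sym (step d)))
      where
      step : ∀ m → + suc m ℤ.* X^ d i ≡ X^ d i ℤ.+ + m ℤ.* X^ d i
      step m = ℤₚ.suc-* (+ m) (X^ d i)

    θq : - θ q ≈ λ n → + d ℤ.* X^ d n
    θq zero    = ≡.sym (ℤₚ.*-zeroʳ (+ d))
    θq (suc n) = ≡.trans (ℤₚ.neg-distribʳ-* (+ suc n) _)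
      (≡.trans (cong (+ suc n ℤ.*_) (≡.trans (cong ℤ.-_ (ℤₚ.+-identityˡ _)) (ℤₚ.neg-involutive _))) (θX d (suc n)))

  -- Powers of q give the multiples with c ≥ 0, and inverses of such powers give the negative ones.
  logDerivative-multiple : ∀ {q T} → LogDerivative q T → ∀ c → ∃ λ q′ → LogDerivative q′ (λ n → c ℤ.* T n)
  logDerivative-multiple {q} {T} L = multiple
    where
    natMultiple : ∀ m → ∃ λ q′ → LogDerivative q′ (λ n → + m ℤ.* T n)
    natMultiple zero    = _ , logDerivative-cong (λ _ → ≡.refl) logDerivative-1
    natMultiple (suc m) with natMultiple m
    ... | _ , M = _ , logDerivative-cong (λ n → ≡.sym (ℤₚ.suc-* (+ m) (T n))) (logDerivative-* L M)
    multiple : ∀ c → ∃ λ q′ → LogDerivative q′ (λ n → c ℤ.* T n)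
    multiple (+ m)    = natMultiple m
    multiple -[1+ m ] with natMultiple (suc m)
    ... | _ , M = _ , logDerivative-cong (λ n → ℤₚ.neg-distribˡ-* (+ suc m) (T n)) (logDerivative-⁻¹ M)

-- Divisibility by prime powers

module PrimePowers where

  open import Data.List.Base using ([]; _∷_)
  open import Data.List.Relation.Unary.All using (_∷_)
  open import Data.Nat.Base
  open import Data.Nat.Coprimality using (Coprime)
  open import Data.Nat.Divisibility
  open import Data.Nat.GCD using (gcd; gcd[m,n]∣m; gcd[m,n]∣n; gcd-greatest)
  open import Data.Nat.Induction using (<-rec)
  open import Data.Nat.ListAction using (product)
  open import Data.Nat.Primality
  open import Data.Nat.Primality.Factorisation using (factorise)
  open import Data.Nat.Properties
  open import Data.Product using (∃; ∃₂; _×_; _,_)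
  open import Data.Sum.Base using (inj₁; inj₂)
  open import Relation.Nullary using (¬_; yes; no; contradiction)
  open import Relation.Binary.PropositionalEquality
  open import Data.Nat.Tactic.RingSolver using (solve-∀)

  primeDivisor : ∀ n .{{_ : NonZero n}} → n ≢ 1 → ∃ λ p → Prime p × p ∣ n
  primeDivisor n n≢1 with factorise n
  ... | record { factors = [] ; isFactorisation = n≡1 } = contradiction n≡1 n≢1
  ... | record { factors = p ∷ ps ; isFactorisation = eq ; factorsPrime = p-prime ∷ _ } =
    p , p-prime , subst (p ∣_) (sym eq) (m∣m*n (product ps))

  primePowerPart : ∀ {p} → Prime p → ∀ n .{{_ : NonZero n}} →
                   ∃₂ λ k m → n ≡ m * p ^ k × ¬ p ∣ m
  primePowerPart {p} p-prime n {{n≢0}} = <-rec P extract n n≢0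
    where
    P : ℕ → Set
    P n = .(NonZero n) → ∃₂ λ k m → n ≡ m * p ^ k × ¬ p ∣ m
    extract : ∀ n → (∀ {q} → q < n → P q) → P n
    extract n rec n≢0 with p ∣? n
    ... | no  p∤n = 0 , n , sym (*-identityʳ n) , p∤n
    ... | yes p∣n with rec (quotient-< p∣n {{prime⇒nonTrivial p-prime}} {{n≢0}}) (quotient≢0 p∣n {{n≢0}})
    ...   | k , m , eq , p∤m =
      suc k , m , trans (_∣_.equality p∣n) (trans (cong (_* p) eq) (rearranged m (p ^ k) p)) , p∤m
      where
      rearranged : ∀ m x p → m * x * p ≡ m * (p * x)
      rearranged = solve-∀

  ∤⇒coprime : ∀ {p m} → Prime p → ¬ p ∣ m → Coprime m p
  ∤⇒coprime p-prime p∤m (d∣m , d∣p) with prime⇒irreducible p-prime d∣p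
  ... | inj₁ d≡1  = d≡1
  ... | inj₂ refl = contradiction d∣m p∤m

  -- Induction on k: by Euclid's lemma p divides d, and one factor p is cancelled on both sides.
  primePower-cancel : ∀ {p e} → Prime p → ¬ p ∣ e → ∀ k d → p ^ k ∣ d * e → p ^ k ∣ d
  primePower-cancel p-prime p∤e zero    d _ = 1∣ d
  primePower-cancel {p} {e} p-prime p∤e (suc k) d p^∣de
    with euclidsLemma d e p-prime (∣-trans (m∣m*n (p ^ k)) p^∣de)
  ... | inj₂ p∣e = contradiction p∣e p∤e
  ... | inj₁ (divides d′ refl) = subst (_∣ d′ * p) (*-comm (p ^ k) p)
    (*-monoˡ-∣ p (primePower-cancel p-prime p∤e k d′
      (*-cancelˡ-∣ p {{prime⇒nonZero p-prime}} (subst (p * p ^ k ∣_) (rearranged d′ p e) p^∣de))))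
    where
    rearranged : ∀ d p e → d * p * e ≡ p * (d * e)
    rearranged = solve-∀

  -- If d e = m pᵏ⁺¹ and p ∣ e, then d divides m pᵏ.
  ∣-primePower : ∀ {p d} → Prime p → ∀ k m → d ∣ m * p ^ suc k → ¬ d ∣ m * p ^ k → p ^ suc k ∣ d
  ∣-primePower {p} {d} p-prime k m (divides e eq) d∤ =
    primePower-cancel p-prime p∤e (suc k) d (divides m (trans (*-comm d e) (sym eq)))
    where
    rearranged : ∀ m p x → m * (p * x) ≡ p * (m * x)
    rearranged = solve-∀
    rearranged′ : ∀ e p d → e * p * d ≡ p * (e * d)
    rearranged′ = solve-∀
    p∤e : ¬ p ∣ e
    p∤e (divides e′ refl) = d∤ (divides e′ (*-cancelˡ-≡ (m * p ^ k) (e′ * d) p {{prime⇒nonZero p-prime}}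
      (trans (sym (rearranged m p (p ^ k))) (trans eq (rearranged′ e′ p d)))))

  -- A prime p dividing n / gcd n x would occur in n to a higher power than in
  -- the gcd.
  primePowers⇒∣ : ∀ n x .{{_ : NonZero n}} →
    (∀ p k m → Prime p → Coprime m p → n ≡ m * p ^ suc k → p ^ suc k ∣ x) → n ∣ x
  primePowers⇒∣ n x hyp with gcd[m,n]∣m n x
  ... | divides e n≡eg with e ≟ 1
  ...   | yes refl = subst (_∣ x) (sym (trans n≡eg (*-identityˡ _))) (gcd[m,n]∣n n x)
  ...   | no  e≢1 with primeDivisor e {{≢-nonZero e≢0}} e≢1
    where
    e≢0 : e ≢ 0
    e≢0 refl = ≢-nonZero⁻¹ n n≡eg
  ...     | p , p-prime , divides e′ refl with primePowerPart p-prime n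
  -- Exponent 0 would mean that p does not divide n, but p divides the cofactor of the gcd.
  ...       | zero  , m , eq , p∤m =
    contradiction (subst (p ∣_) (trans (sym n≡eg) (trans eq (*-identityʳ m)))
      (∣-trans (n∣m*n e′) (m∣m*n (gcd n x)))) p∤m
  ...       | suc k , m , eq , p∤m
    with gcd-greatest {n} {x} (subst (p ^ suc k ∣_) (sym eq) (n∣m*n m))
           (hyp p k m p-prime (∤⇒coprime p-prime p∤m) eq)
  ...         | divides c g≡ = contradiction (divides (e′ * c) m≡) p∤m
    where
    rearranged : ∀ e p c x → e * p * (c * x) ≡ e * c * p * x
    rearranged = solve-∀
    m≡ : m ≡ e′ * c * p
    m≡ = *-cancelʳ-≡ m (e′ * c * p) (p ^ suc k) {{m^n≢0 p (suc k) {{prime⇒nonZero p-prime}}}}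
      (trans (sym eq) (trans n≡eg (trans (cong (e′ * p *_) g≡) (rearranged e′ p c (p ^ suc k)))))

-- Gauss congruences and approximation by combinations of the series δ d

module GaussCongruences where

  open PowerSeries using (Series; _≗[_]_)
  open LogarithmicDerivatives
  open PrimePowers
  open import Data.Integer.Base hiding (suc; _≤_; _<_)
  open import Data.Integer.Divisibility.Signed
  open import Data.Integer.Properties hiding (_≟_; _≤?_)
  open import Data.Integer.Tactic.RingSolver using (solve-∀)
  open import Data.Nat.Base as ℕ using (ℕ; zero; suc; _≤_; _<_; s≤s)
  import Data.Nat.Properties as ℕₚ
  open import Data.Nat.Coprimality using (Coprime)
  import Data.Nat.Divisibility as ℕᵈ
  open import Data.Nat.Primality using (Prime; prime⇒nonZero; prime⇒nonTrivial)
  open import Data.Product using (∃; _×_; _,_)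
  open import Data.Sum.Base using (inj₁; inj₂)
  open import Relation.Nullary using (yes; no)
  open import Relation.Binary.PropositionalEquality

  -- With n written as m p^(k+1), the index n/p is m p^k and no division occurs.
  Gauss : ℕ → Series → Set
  Gauss r T = ∀ p k m → Prime p → Coprime m p → m ℕ.* p ℕ.^ suc k ≤ r →
    + (p ℕ.^ suc k) ∣ T (m ℕ.* p ℕ.^ suc k) - T (m ℕ.* p ℕ.^ k)

  gauss-0 : ∀ {r} → Gauss r (λ _ → 0ℤ)
  gauss-0 p k m _ _ _ = divides 0ℤ refl

  gauss-+ : ∀ {r} S T → Gauss r S → Gauss r T → Gauss r (λ n → S n + T n)
  gauss-+ S T gS gT p k m p-prime m⊥p ≤r = subst (_ ∣_)
    (regroup (S (m ℕ.* p ℕ.^ suc k)) (S (m ℕ.* p ℕ.^ k)) _ _)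
    (∣m∣n⇒∣m+n (gS p k m p-prime m⊥p ≤r) (gT p k m p-prime m⊥p ≤r))
    where
    regroup : ∀ a b c d → a - b + (c - d) ≡ a + c - (b + d)
    regroup = solve-∀

  gauss-minus : ∀ {r} S T → Gauss r S → Gauss r T → Gauss r (λ n → S n - T n)
  gauss-minus S T gS gT p k m p-prime m⊥p ≤r = subst (_ ∣_)
    (regroup (S (m ℕ.* p ℕ.^ suc k)) (S (m ℕ.* p ℕ.^ k)) _ _)
    (∣m∣n⇒∣m-n (gS p k m p-prime m⊥p ≤r) (gT p k m p-prime m⊥p ≤r))
    where
    regroup : ∀ a b c d → a - b - (c - d) ≡ a - c - (b - d)
    regroup = solve-∀

  gauss-* : ∀ {r} T c → Gauss r T → Gauss r (λ n → c * T n)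
  gauss-* T c gT p k m p-prime m⊥p ≤r = subst (_ ∣_)
    (expand c (T (m ℕ.* p ℕ.^ suc k)) _)
    (∣n⇒∣m*n c (gT p k m p-prime m⊥p ≤r))
    where
    expand : ∀ c a b → c * (a - b) ≡ c * a - c * b
    expand = solve-∀

  gauss-cong : ∀ {r S T} → S ≗[ r ] T → Gauss r S → Gauss r T
  gauss-cong S≗T gS p k m p-prime m⊥p ≤r = subst (_ ∣_)
    (cong₂ _-_ (S≗T _ ≤r)
      (S≗T _ (ℕₚ.≤-trans (ℕₚ.*-monoʳ-≤ m (ℕₚ.m≤n*m (p ℕ.^ k) p {{prime⇒nonZero p-prime}})) ≤r)))
    (gS p k m p-prime m⊥p ≤r)

  -- Let n = m p^(k+1). If d divides n/p, both values are d; if d does not divide n, both are 0. In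
  -- the remaining case the difference is d, which contains the factor p^(k+1) by `∣-primePower`.
  gauss-δ : ∀ {r} d → Gauss r (δ d)
  gauss-δ d p k zero _ _ _ = divides 0ℤ refl
  gauss-δ d p k m@(suc _) p-prime _ _ with d ℕᵈ.∣? (m ℕ.* p ℕ.^ k) | d ℕᵈ.∣? (m ℕ.* p ℕ.^ suc k)
  ... | yes d∣mpᵏ | _ = divides 0ℤ (i≡j⇒i-j≡0 (trans
          (value (suc k) (ℕᵈ.∣-trans d∣mpᵏ (ℕᵈ.*-monoʳ-∣ m (ℕᵈ.n∣m*n p)))) (sym (value k d∣mpᵏ))))
    where
    instance _ = prime⇒nonZero p-prime
    value : ∀ j → d ℕᵈ.∣ m ℕ.* p ℕ.^ j → δ d (m ℕ.* p ℕ.^ j) ≡ + d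
    value j = δ-∣ _ {{ℕₚ.m*n≢0 m (p ℕ.^ j) {{_}} {{ℕₚ.m^n≢0 p j}}}}
  ... | no d∤mpᵏ | no d∤mpᵏ⁺¹ = divides 0ℤ (i≡j⇒i-j≡0 (trans (δ-∤ _ d∤mpᵏ⁺¹) (sym (δ-∤ _ d∤mpᵏ))))
  ... | no d∤mpᵏ | yes d∣mpᵏ⁺¹ = subst (_ ∣_)
    (sym (trans (cong₂ _-_ (δ-∣ (m ℕ.* p ℕ.^ suc k) d∣mpᵏ⁺¹) (δ-∤ (m ℕ.* p ℕ.^ k) d∤mpᵏ)) (+-identityʳ (+ d))))
    (∣ᵤ⇒∣ (∣-primePower p-prime k m d∣mpᵏ⁺¹ d∤mpᵏ))
    where
    instance _ = ℕₚ.m*n≢0 m (p ℕ.^ suc k) {{_}} {{ℕₚ.m^n≢0 p (suc k) {{prime⇒nonZero p-prime}}}}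

  -- For each prime power p^(k+1) exactly dividing N + 1, the congruence compares `T (suc N)` with
  -- an earlier coefficient, which is 0. So all these prime powers divide `T (suc N)`, and with them
  -- N + 1.
  gauss-leading : ∀ {r T} → Gauss r T → ∀ N → suc N ≤ r → (∀ i → i < suc N → T i ≡ 0ℤ) → + suc N ∣ T (suc N)
  gauss-leading {r} {T} gT N N<r T≡0 = ∣ᵤ⇒∣ (primePowers⇒∣ (suc N) ∣ T (suc N) ∣ dividing)
    where
    dividing : ∀ p k m → Prime p → Coprime m p → suc N ≡ m ℕ.* p ℕ.^ suc k → p ℕ.^ suc k ℕᵈ.∣ ∣ T (suc N) ∣
    dividing p k m p-prime m⊥p eq = ∣⇒∣ᵤ (subst (+ (p ℕ.^ suc k) ∣_)
      (trans (cong₂ _-_ (cong T (sym eq)) (T≡0 _ smaller)) (+-identityʳ (T (suc N))))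
      (gT p k m p-prime m⊥p (subst (_≤ r) eq N<r)))
      where
      smaller : m ℕ.* p ℕ.^ k < suc N
      smaller = subst (m ℕ.* p ℕ.^ k <_) (sym eq)
        (ℕₚ.*-monoʳ-< m {{ℕₚ.m*n≢0⇒m≢0 m {{subst ℕ.NonZero eq _}}}}
          (ℕₚ.^-monoʳ-< p (ℕ.nonTrivial⇒n>1 p {{prime⇒nonTrivial p-prime}}) (ℕₚ.n<1+n k)))

  IsLogDerivative : Series → Set
  IsLogDerivative T = ∃ λ q → LogDerivative q T

  -- `D` collects the multiples of δ d subtracted so far, so it is a logarithmic derivative and
  -- satisfies the congruences. The remainder `S` keeps the property `P`, which lets the subtraction
  -- continue. `P` will be `IsLogDerivative` or `Gauss r`.
  record Approximable (P : Series → Set) (T : Series) (N : ℕ) : Set where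
    field
      D S             : Series
      isLogDerivative : IsLogDerivative D
      gauss           : ∀ {r} → Gauss r D
      remainder       : P S
      split           : ∀ n → T n ≡ D n + S n
      vanishing       : ∀ i → i < suc N → S i ≡ 0ℤ

    agreement : T ≗[ N ] D
    agreement i i≤N = begin
      T i        ≡⟨ split i ⟩
      D i + S i  ≡⟨ cong (λ z → D i + z) (vanishing i (s≤s i≤N)) ⟩
      D i + 0ℤ   ≡⟨ +-identityʳ (D i) ⟩
      D i        ∎
      where open ≡-Reasoning

  -- Successively subtract c δ(N), where c N is the leading coefficient of the remainder.
  approximate : ∀ (P : Series → Set) r →
    (∀ {T} d c → P T → P (λ n → T n - c * δ (suc d) n)) →
    (∀ {T} → P T → ∀ N → suc N ≤ r → (∀ i → i < suc N → T i ≡ 0ℤ) → + suc N ∣ T (suc N)) →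
    ∀ {T} → P T → T 0 ≡ 0ℤ → ∀ N → N ≤ r → Approximable P T N
  approximate P r subtract leading {T} PT T₀≡0 zero    _   = record
    { D = λ _ → 0ℤ ; S = T ; isLogDerivative = _ , logDerivative-cong (λ _ → refl) logDerivative-1
    ; gauss = gauss-0 ; remainder = PT ; split = λ n → sym (+-identityˡ (T n))
    ; vanishing = λ { zero _ → T₀≡0 ; (suc _) (s≤s ()) } }
  approximate P r subtract leading {T} PT T₀≡0 (suc N) N<r
    with approximate P r subtract leading PT T₀≡0 N (ℕₚ.<⇒≤ N<r)
  ... | record { D = D ; S = S ; isLogDerivative = _ , LD ; gauss = gD
               ; remainder = PS ; split = T≡D+S ; vanishing = S≡0 }
    with leading PS N N<r S≡0 | logDerivative-multiple (logDerivative-δ N)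
  ...   | divides c S≡cN | multiple = record
    { D = λ n → D n + c * δ (suc N) n
    ; S = λ n → S n - c * δ (suc N) n
    ; isLogDerivative = let _ , M = multiple c in _ , logDerivative-* LD M
    ; gauss = gauss-+ D (λ n → c * δ (suc N) n) gD (gauss-* (δ (suc N)) c (gauss-δ (suc N)))
    ; remainder = subtract N c PS
    ; split = λ n → trans (T≡D+S n) (regroup (D n) (S n) (c * δ (suc N) n))
    ; vanishing = vanish }
    where
    regroup : ∀ a b x → a + b ≡ a + x + (b - x)
    regroup = solve-∀
    vanish : ∀ i → i < suc (suc N) → S i - c * δ (suc N) i ≡ 0ℤ
    -- The series δ (N + 1) starts in degree N + 1 with coefficient N + 1: the zeros below survive,
    -- and the leading coefficient cancels.
    vanish i i<2+N with ℕₚ.m<1+n⇒m<n∨m≡n i<2+N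
    ... | inj₁ i<1+N = cong₂ _-_ (S≡0 i i<1+N) (trans (cong (c *_) (δ-< i i<1+N)) (*-zeroʳ c))
    ... | inj₂ refl  = i≡j⇒i-j≡0 (trans S≡cN (cong (c *_) (sym (δ-∣ (suc N) ℕᵈ.∣-refl))))

  -- Logarithmic derivatives are preserved by subtracting multiples of δ d, so T agrees up to degree
  -- r with a combination `D` of these. The congruences bounded by r see only those degrees and hold
  -- for `D`.
  logDerivative⇒gauss : ∀ {T} → IsLogDerivative T → ∀ r → Gauss r T
  logDerivative⇒gauss {T} isL@(_ , L) r = gauss-cong {S = D} (λ i i≤r → sym (agreement i i≤r)) gauss
    where
    approximation : Approximable IsLogDerivative T r
    approximation = approximate IsLogDerivative r
      (λ { d c (_ , L) → let _ , M = logDerivative-multiple (logDerivative-δ d) c in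
        _ , logDerivative-* L (logDerivative-⁻¹ M) })
      -- The constant coefficient of `θ u * q` reduces to 0, so `formula L 0` proves that T has no
      -- constant term.
      (λ { (_ , L) N _ → logDerivative-leading L (suc N) }) isL (LogDerivative.formula L 0) r ℕₚ.≤-refl
    open Approximable approximation

  -- The same reduction, now with the congruences as the preserved property; `D` is used for being a
  -- logarithmic derivative.
  gauss⇒logDerivative : ∀ {T} r → Gauss r T → T 0 ≡ 0ℤ → ∃ λ D → IsLogDerivative D × T ≗[ r ] D
  gauss⇒logDerivative {T} r gT T₀≡0 = D , isLogDerivative , agreement
    where
    approximation : Approximable (Gauss r) T r
    approximation = approximate (Gauss r) r
      (λ {S} d c gS → gauss-minus S (λ n → c * δ (suc d) n) gS (gauss-* (δ (suc d)) c (gauss-δ (suc d))))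
      gauss-leading gT T₀≡0 r ℕₚ.≤-refl
    open Approximable approximation

-- Traces of matrix powers as logarithmic derivatives

module MatrixTraces where

  open import Defs
  open PowerSeries
  open LogarithmicDerivatives
  open GaussCongruences using (IsLogDerivative)
  open import Algebra.Bundles using (module CommutativeRing)
  open import Data.Bool.Base using (if_then_else_)
  open import Data.Fin.Base using (Fin; zero; suc; toℕ)
  open import Data.Fin.Properties using (toℕ<n)
  open import Data.Integer.Base hiding (suc; _≤_; _<_)
  open import Data.Integer.Properties hiding (_≟_)
  open import Algebra.Properties.Semiring.Sum +-*-semiring
    using (sum; sum-cong-≗; *-distribˡ-sum; *-distribʳ-sum; ∑-distrib-+; ∑-comm)
  open import Algebra.Properties.Ring (CommutativeRing.ring seriesRing) using (-‿distribˡ-*)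
  open import Data.Integer.Tactic.RingSolver using (solve-∀)
  open import Data.Nat.Base as ℕ using (ℕ; zero; suc; _≤_; _<_; z≤n; s≤s; _≡ᵇ_)
  import Data.Nat.Properties as ℕₚ
  open import Data.Product using (∃; _×_; _,_)
  open import Data.Vec.Functional using (Vector)
  open import Function.Base using (_∘_)
  open import Relation.Binary.PropositionalEquality
  open ≡-Reasoning

  infixl 7 _∙_ _·ᵥ_

  _∙_ : ∀ {s} → Vector ℤ s → Vector ℤ s → ℤ
  x ∙ z = sum λ k → x k * z k

  _·ᵥ_ : ∀ {s} → SquareMatrix s → Vector ℤ s → Vector ℤ s
  (D ·ᵥ z) i = D i ∙ z

  -- This is Dⁱ z with the new factor placed next to z. Thus `act D i (D ·ᵥ z)` is `act D (suc i) z`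
  -- by definition, as the recurrences in `Block` require.
  act : ∀ {s} → SquareMatrix s → ℕ → Vector ℤ s → Vector ℤ s
  act D zero    z = z
  act D (suc i) z = act D i (D ·ᵥ z)

  ∙-cong : ∀ {s} {x x′ z z′ : Vector ℤ s} → x ≗ x′ → z ≗ z′ → x ∙ z ≡ x′ ∙ z′
  ∙-cong p q = sum-cong-≗ (λ k → cong₂ _*_ (p k) (q k))

  ∙-comm : ∀ {s} (x z : Vector ℤ s) → x ∙ z ≡ z ∙ x
  ∙-comm x z = sum-cong-≗ (λ k → *-comm (x k) (z k))

  -- The combination v c + z is the shape of a column of Aⁿ⁺¹ below vertex 0: the column v of A
  -- times an entry in row 0 of Aⁿ, plus D applied to a column of Aⁿ.
  ∙-linear : ∀ {s} (x v z : Vector ℤ s) c → x ∙ (λ k → v k * c + z k) ≡ (x ∙ v) * c + x ∙ z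
  ∙-linear x v z c = begin
    sum (λ k → x k * (v k * c + z k))                ≡⟨ sum-cong-≗ (λ k → expand (x k) (v k) c (z k)) ⟩
    sum (λ k → x k * v k * c + x k * z k)            ≡⟨ ∑-distrib-+ (λ k → x k * v k * c) (λ k → x k * z k) ⟩
    sum (λ k → x k * v k * c) + x ∙ z                ≡⟨ cong (_+ x ∙ z) (*-distribʳ-sum c (λ k → x k * v k)) ⟨
    (x ∙ v) * c + x ∙ z                              ∎
    where
    expand : ∀ x v c z → x * (v * c + z) ≡ x * v * c + x * z
    expand = solve-∀

  ∙-zeroˡ : ∀ {s} (z : Vector ℤ s) → (λ _ → 0ℤ) ∙ z ≡ 0ℤ
  ∙-zeroˡ z = sym (*-distribˡ-sum 0ℤ z)

  ∙-zeroʳ : ∀ {s} (x : Vector ℤ s) → x ∙ (λ _ → 0ℤ) ≡ 0ℤ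
  ∙-zeroʳ x = trans (∙-comm x _) (∙-zeroˡ x)

  ∙-assoc : ∀ {s} (x : Vector ℤ s) (D : SquareMatrix s) z →
            (λ j → x ∙ (λ k → D k j)) ∙ z ≡ x ∙ (D ·ᵥ z)
  ∙-assoc x D z = begin
    sum (λ j → (x ∙ (λ k → D k j)) * z j)
      ≡⟨ sum-cong-≗ (λ j → *-distribʳ-sum (z j) (λ k → x k * D k j)) ⟩
    sum (λ j → sum λ k → x k * D k j * z j)
      ≡⟨ ∑-comm (λ j k → x k * D k j * z j) ⟩
    sum (λ k → sum λ j → x k * D k j * z j)
      ≡⟨ sum-cong-≗ (λ k → trans (sum-cong-≗ (λ j → *-assoc (x k) (D k j) (z j)))
                                 (sym (*-distribˡ-sum (x k) (λ j → D k j * z j)))) ⟩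
    x ∙ (D ·ᵥ z) ∎

  act-cong : ∀ {s} (D : SquareMatrix s) i {z z′} → z ≗ z′ → act D i z ≗ act D i z′
  act-cong D zero    p = p
  act-cong D (suc i) p = act-cong D i (λ k → ∙-cong {x = D k} (λ _ → refl) p)

  act-linear : ∀ {s} (D : SquareMatrix s) i v z c →
               act D i (λ k → v k * c + z k) ≗ λ k → act D i v k * c + act D i z k
  act-linear D zero    v z c k = refl
  act-linear D (suc i) v z c k = trans
    (act-cong D i (λ l → ∙-linear (D l) v z c) k)
    (act-linear D i (D ·ᵥ v) (D ·ᵥ z) c k)

  act-zero : ∀ {s} (D : SquareMatrix s) i → act D i (λ _ → 0ℤ) ≗ λ _ → 0ℤ
  act-zero D zero    k = refl
  act-zero D (suc i) k = trans (act-cong D i (λ l → ∙-zeroʳ (D l)) k) (act-zero D i k)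

  act-suc : ∀ {s} (D : SquareMatrix s) i z → act D (suc i) z ≗ D ·ᵥ act D i z
  act-suc D zero    z k = refl
  act-suc D (suc i) z k = act-suc D i (D ·ᵥ z) k

  ^ᴹ-act : ∀ {s} (D : SquareMatrix s) i k j → (D ^ᴹ i) k j ≡ act D i (λ l → identity l j) k
  ^ᴹ-act D zero    k j = refl
  ^ᴹ-act D (suc i) k j = trans
    (∙-cong {x = D k} (λ _ → refl) (λ l → ^ᴹ-act D i l j))
    (sym (act-suc D i (λ l → identity l j) k))

  identity-∙ : ∀ {s} (i : Fin s) z → identity i ∙ z ≡ z i
  identity-∙ {suc s} zero z = trans
    (cong₂ _+_ (*-identityˡ (z zero)) (∙-zeroˡ (z ∘ suc))) (+-identityʳ (z zero))
  identity-∙ {suc s} (suc i) z = trans (+-identityˡ _) (identity-∙ i (z ∘ suc))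

  identity-sym : ∀ {s} (i j : Fin s) → identity i j ≡ identity j i
  identity-sym zero    zero    = refl
  identity-sym zero    (suc j) = refl
  identity-sym (suc i) zero    = refl
  identity-sym (suc i) (suc j) = identity-sym i j

  -- Powers are built by multiplication on the left; the recurrence for row 0 of the powers needs
  -- the factor on the right.
  ^ᴹ-suc : ∀ {s} (A : SquareMatrix s) n i j → (A ^ᴹ suc n) i j ≡ ((A ^ᴹ n) · A) i j
  ^ᴹ-suc A zero i j = begin
    A i ∙ (λ k → identity k j)   ≡⟨ ∙-comm (A i) _ ⟩
    (λ k → identity k j) ∙ A i   ≡⟨ ∙-cong {z = A i} (λ k → identity-sym k j) (λ _ → refl) ⟩
    identity j ∙ A i             ≡⟨ identity-∙ j (A i) ⟩
    A i j                        ≡⟨ identity-∙ i (λ k → A k j) ⟨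
    identity i ∙ (λ k → A k j)   ∎
  ^ᴹ-suc A (suc n) i j = begin
    A i ∙ (λ k → (A ^ᴹ suc n) k j)         ≡⟨ ∙-cong {x = A i} (λ _ → refl) (λ k → ^ᴹ-suc A n k j) ⟩
    A i ∙ ((A ^ᴹ n) ·ᵥ (λ k → A k j))      ≡⟨ ∙-assoc (A i) (A ^ᴹ n) (λ k → A k j) ⟨
    ((A ^ᴹ suc n) · A) i j                 ∎

  -- The constant term is 0 instead of the trace of the identity, since logarithmic derivatives have
  -- no constant term.
  traces : ∀ {s} → SquareMatrix s → Series
  traces A zero    = 0ℤ
  traces A (suc n) = Tr (A ^ᴹ suc n)

  -- 1 − X F.
  returnDenominator : Series → Series
  returnDenominator F zero    = 1ℤ
  returnDenominator F (suc n) = - F n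

  -- X (X F)′ g.
  returnTraces : (F g : Series) → Series
  returnTraces F g zero    = 0ℤ
  returnTraces F g (suc n) = ((λ j → + suc j * F j) ⊛ g) n

  -- The hypotheses say g = 1 + X F g, so g is the inverse of q = 1 - X F. The formula is then -X q′
  -- g = X (X F)′ g.
  logDerivative-returns : ∀ F g → g 0 ≡ 1ℤ → (∀ n → g (suc n) ≡ (F ⊛ g) n) →
                          LogDerivative (returnDenominator F) (returnTraces F g)
  logDerivative-returns F g g₀≡1 g-suc = record
    { u = g ; u₀≡1 = g₀≡1 ; q₀≡1 = refl ; inverse = gq≈1
    ; formula = λ n → trans (formula n) (sym (θ-inverse g q gq≈1 n)) }
    where
    q = returnDenominator F
    gq≈1 : g ⊛ q ≗ X^ 0
    gq≈1 n = trans (⊛-comm g q n) (qg≈1 n)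
      where
      qg≈1 : q ⊛ g ≗ X^ 0
      qg≈1 zero    = trans (*-identityˡ (g 0)) g₀≡1
      qg≈1 (suc n) = begin
        1ℤ * g (suc n) + ((λ j → - F j) ⊛ g) n  ≡⟨ cong₂ _+_ (*-identityˡ (g (suc n))) (sym (-‿distribˡ-* F g n)) ⟩
        g (suc n) - (F ⊛ g) n                   ≡⟨ i≡j⇒i-j≡0 (g-suc n) ⟩
        0ℤ                                      ∎
    formula : ∀ n → returnTraces F g n ≡ - (θ q ⊛ g) n
    formula zero    = refl
    formula (suc n) = sym (begin
      - (0ℤ * g (suc n) + (θ q ∘ suc ⊛ g) n)    ≡⟨ cong -_ (+-identityˡ _) ⟩
      - (θ q ∘ suc ⊛ g) n                       ≡⟨ -‿distribˡ-* (θ q ∘ suc) g n ⟩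
      ((λ j → - (+ suc j * - F j)) ⊛ g) n       ≡⟨ ⊛-cong {g = g} (λ j → negate (+ suc j) (F j)) (λ _ → refl) n ⟩
      ((λ j → + suc j * F j) ⊛ g) n             ∎)
      where
      negate : ∀ a b → - (a * - b) ≡ a * b
      negate = solve-∀

  -- Each use of the recurrence moves one unit from n to i and leaves a term F (i + 1 + j) g (n -
  -- j), until c 0 contributes 0. These terms form a Cauchy product.
  shiftedConvolution : ∀ (F g : Series) (c : ℕ → ℕ → ℤ) → (∀ i → c 0 i ≡ 0ℤ) →
    (∀ n i → c (suc n) i ≡ F (suc i) * g n + c n (suc i)) →
    ∀ n i → c (suc n) i ≡ ((λ j → F (suc (i ℕ.+ j))) ⊛ g) n
  shiftedConvolution F g c c₀ c-suc zero i = begin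
    c 1 i                              ≡⟨ c-suc 0 i ⟩
    F (suc i) * g 0 + c 0 (suc i)      ≡⟨ cong₂ _+_ (cong (λ k → F (suc k) * g 0) (sym (ℕₚ.+-identityʳ i)))
                                                (c₀ (suc i)) ⟩
    F (suc (i ℕ.+ 0)) * g 0 + 0ℤ       ≡⟨ +-identityʳ _ ⟩
    F (suc (i ℕ.+ 0)) * g 0            ∎
  shiftedConvolution F g c c₀ c-suc (suc n) i = trans (c-suc (suc n) i) (cong₂ _+_
    (cong (λ k → F (suc k) * g (suc n)) (sym (ℕₚ.+-identityʳ i)))
    (trans (shiftedConvolution F g c c₀ c-suc n (suc i))
           (⊛-cong {g = g} (λ j → cong (F ∘ suc) (sym (ℕₚ.+-suc i j))) (λ _ → refl) n)))

  -- Deleting vertex 0 from a matrix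

  module Block {s} (A : SquareMatrix (suc s)) where

    D : SquareMatrix s
    D i j = A (suc i) (suc j)

    v w : Vector ℤ s
    v i = A (suc i) zero
    w j = A zero (suc j)

    -- F n is the total weight of the closed walks of length n + 1 that meet the
    -- vertex 0 only at their ends.
    F : Series
    F zero    = A zero zero
    F (suc i) = w ∙ act D i v

    g : Series
    g n = (A ^ᴹ n) zero zero

    h y : ℕ → Vector ℤ s
    h n i = (A ^ᴹ n) (suc i) zero
    y n j = (A ^ᴹ n) zero (suc j)

    -- The column index j comes first, so that `Z n j` is a column to which `act D i` applies.
    Z : ℕ → Fin s → Vector ℤ s
    Z n j i = (A ^ᴹ n) (suc i) (suc j)

    -- Column 0 satisfies h (n + 1) = v g n + D h n, and h 0 = 0; applying w Dⁱ gives the recurrence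
    -- of `shiftedConvolution`.
    w∙h : ∀ n i → w ∙ act D i (h (suc n)) ≡ ((λ j → F (suc (i ℕ.+ j))) ⊛ g) n
    w∙h = shiftedConvolution F g (λ n i → w ∙ act D i (h n))
      (λ i → trans (∙-cong {x = w} (λ _ → refl) (act-zero D i)) (∙-zeroʳ w))
      (λ n i → trans (∙-cong {x = w} (λ _ → refl) (act-linear D i v (D ·ᵥ h n) (g n)))
                     (∙-linear w (act D i v) (act D (suc i) (h n)) (g n)))

    -- A nonempty closed walk at vertex 0 splits at its first return: F counts the part before it, g
    -- the part after it.
    g-suc : ∀ n → g (suc n) ≡ (F ⊛ g) n
    g-suc zero    = trans (cong (λ z → F 0 * 1ℤ + z) (∙-zeroʳ w)) (+-identityʳ _)
    g-suc (suc n) = cong (λ z → F 0 * g (suc n) + z) (w∙h n 0)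

    -- The transposed counterpart of `w∙h`, from y (n + 1) = g n w + y n D for row 0.
    y∙v : ∀ n i → y (suc n) ∙ act D i v ≡ ((λ j → F (suc (i ℕ.+ j))) ⊛ g) n
    y∙v = shiftedConvolution F g (λ n i → y n ∙ act D i v) (λ i → ∙-zeroˡ (act D i v)) step
      where
      step : ∀ n i → y (suc n) ∙ act D i v ≡ F (suc i) * g n + y n ∙ act D (suc i) v
      step n i = begin
        y (suc n) ∙ z
          ≡⟨ ∙-cong {z = z} (λ j → trans (^ᴹ-suc A n zero (suc j))
               (cong (_+ y n ∙ (λ k → D k j)) (*-comm (g n) (w j)))) (λ _ → refl) ⟩
        (λ j → w j * g n + y n ∙ (λ k → D k j)) ∙ z
          ≡⟨ ∙-comm _ z ⟩
        z ∙ (λ j → w j * g n + y n ∙ (λ k → D k j))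
          ≡⟨ ∙-linear z w (λ j → y n ∙ (λ k → D k j)) (g n) ⟩
        (z ∙ w) * g n + z ∙ (λ j → y n ∙ (λ k → D k j))
          ≡⟨ cong₂ (λ a b → a * g n + b) (∙-comm z w) (trans (∙-comm z _) (∙-assoc (y n) D z)) ⟩
        (w ∙ z) * g n + y n ∙ (D ·ᵥ z)
          ≡⟨ cong (λ a → (w ∙ z) * g n + a) (∙-cong {x = y n} (λ _ → refl) (λ k → sym (act-suc D i v k))) ⟩
        F (suc i) * g n + y n ∙ act D (suc i) v ∎
        where z = act D i v

    -- The trace of Dⁱ times the lower right block of Aⁿ. It leads from that block's own trace at i
    -- = 0 to the traces of powers of D at n = 0.
    Q : ℕ → ℕ → ℤ
    Q n i = sum λ j → act D i (Z n j) j

    Q-zero : ∀ i → Q 0 i ≡ Tr (D ^ᴹ i)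
    Q-zero i = sum-cong-≗ (λ j → sym (^ᴹ-act D i j j))

    -- The lower right block of Aⁿ⁺¹ is v y n plus D times that of Aⁿ, and the rank one matrix Dⁱ v
    -- y n has trace y n ∙ Dⁱ v.
    Q-suc : ∀ n i → Q (suc n) i ≡ y n ∙ act D i v + Q n (suc i)
    Q-suc n i = begin
      sum (λ j → act D i (Z (suc n) j) j)
        ≡⟨ sum-cong-≗ (λ j → act-linear D i v (D ·ᵥ Z n j) (y n j) j) ⟩
      sum (λ j → act D i v j * y n j + act D (suc i) (Z n j) j)
        ≡⟨ ∑-distrib-+ (λ j → act D i v j * y n j) _ ⟩
      act D i v ∙ y n + Q n (suc i)
        ≡⟨ cong (_+ Q n (suc i)) (∙-comm (act D i v) (y n)) ⟩
      y n ∙ act D i v + Q n (suc i) ∎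

    Q-one : ∀ i → Q 1 i ≡ Tr (D ^ᴹ suc i)
    Q-one i = trans (Q-suc 0 i) (trans (cong₂ _+_ (∙-zeroˡ (act D i v)) (Q-zero (suc i))) (+-identityˡ _))

    -- Unrolling `Q-suc` adds up the convolutions from `y∙v` for i, i + 1, and so on. The term F (i
    -- + 1 + j) g (n - j) occurs in the first j + 1 of them, hence the weight j + 1.
    Q-formula : ∀ n i → Q (2 ℕ.+ n) i ≡
      ((λ j → + suc j * F (suc (i ℕ.+ j))) ⊛ g) n + Tr (D ^ᴹ suc (suc (n ℕ.+ i)))
    Q-formula zero i = begin
      Q 2 i
        ≡⟨ Q-suc 1 i ⟩
      y 1 ∙ act D i v + Q 1 (suc i)
        ≡⟨ cong₂ _+_ (y∙v 0 i) (Q-one (suc i)) ⟩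
      F (suc (i ℕ.+ 0)) * g 0 + Tr (D ^ᴹ suc (suc i))
        ≡⟨ cong (λ a → a * g 0 + Tr (D ^ᴹ suc (suc i))) (*-identityˡ (F (suc (i ℕ.+ 0)))) ⟨
      1ℤ * F (suc (i ℕ.+ 0)) * g 0 + Tr (D ^ᴹ suc (suc i)) ∎
    Q-formula (suc n) i = begin
      Q (3 ℕ.+ n) i
        ≡⟨ Q-suc (2 ℕ.+ n) i ⟩
      y (2 ℕ.+ n) ∙ act D i v + Q (2 ℕ.+ n) (suc i)
        ≡⟨ cong₂ _+_ (y∙v (suc n) i) (Q-formula n (suc i)) ⟩
      F (suc (i ℕ.+ 0)) * g (suc n) + ((λ j → F (suc (i ℕ.+ suc j))) ⊛ g) n
        + (((λ j → + suc j * F (suc (suc i ℕ.+ j))) ⊛ g) n + Tr (D ^ᴹ suc (suc (n ℕ.+ suc i))))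
        ≡⟨ regroup (F (suc (i ℕ.+ 0))) (g (suc n)) _ _ _ ⟩
      1ℤ * F (suc (i ℕ.+ 0)) * g (suc n)
        + (((λ j → F (suc (i ℕ.+ suc j))) ⊛ g) n + ((λ j → + suc j * F (suc (suc i ℕ.+ j))) ⊛ g) n)
        + Tr (D ^ᴹ suc (suc (n ℕ.+ suc i)))
        ≡⟨ cong₂ (λ a k → 1ℤ * F (suc (i ℕ.+ 0)) * g (suc n) + a + Tr (D ^ᴹ suc (suc k)))
             (trans (sym (⊛-distribʳ g _ _ n)) (⊛-cong {g = g} collect (λ _ → refl) n)) (ℕₚ.+-suc n i) ⟩
      1ℤ * F (suc (i ℕ.+ 0)) * g (suc n) + ((λ j → + suc (suc j) * F (suc (i ℕ.+ suc j))) ⊛ g) n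
        + Tr (D ^ᴹ suc (suc (suc n ℕ.+ i))) ∎
      where
      regroup : ∀ a b x z t → a * b + x + (z + t) ≡ 1ℤ * a * b + (x + z) + t
      regroup = solve-∀
      collect : ∀ j → F (suc (i ℕ.+ suc j)) + + suc j * F (suc (suc i ℕ.+ j)) ≡
                      + suc (suc j) * F (suc (i ℕ.+ suc j))
      collect j = trans (cong (λ k → F (suc (i ℕ.+ suc j)) + + suc j * F (suc k)) (sym (ℕₚ.+-suc i j)))
        (sym (suc-* (+ suc j) (F (suc (i ℕ.+ suc j)))))

    -- Closed walks avoiding vertex 0 are counted by D. In any other, the starting point lies on a
    -- first return loop of some length j + 1, at one of j + 1 positions, and the rest is a closed
    -- walk at 0. In the computation, `g-suc` supplies the position at vertex 0 and `Q-formula` the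
    -- other j.
    traces-split : traces A ≗ λ n → traces D n + returnTraces F g n
    traces-split zero = refl
    traces-split (suc zero) = begin
      g 1 + Q 1 0                      ≡⟨ cong₂ _+_ (g-suc 0) (Q-one 0) ⟩
      F 0 * 1ℤ + Tr (D ^ᴹ 1)           ≡⟨ +-comm (F 0 * 1ℤ) _ ⟩
      Tr (D ^ᴹ 1) + F 0 * 1ℤ           ≡⟨ cong (λ a → Tr (D ^ᴹ 1) + a * 1ℤ) (*-identityˡ (F 0)) ⟨
      Tr (D ^ᴹ 1) + 1ℤ * F 0 * 1ℤ      ∎
    traces-split (suc (suc n)) = begin
      g (2 ℕ.+ n) + Q (2 ℕ.+ n) 0
        ≡⟨ cong₂ _+_ (g-suc (suc n)) (Q-formula n 0) ⟩
      F 0 * g (suc n) + (F ∘ suc ⊛ g) n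
        + (((λ j → + suc j * F (suc j)) ⊛ g) n + Tr (D ^ᴹ suc (suc (n ℕ.+ 0))))
        ≡⟨ regroup (F 0) (g (suc n)) _ _ (Tr (D ^ᴹ suc (suc (n ℕ.+ 0)))) ⟩
      Tr (D ^ᴹ suc (suc (n ℕ.+ 0))) + (1ℤ * F 0 * g (suc n)
        + ((F ∘ suc ⊛ g) n + ((λ j → + suc j * F (suc j)) ⊛ g) n))
        ≡⟨ cong₂ (λ k a → Tr (D ^ᴹ suc (suc k)) + (1ℤ * F 0 * g (suc n) + a)) (ℕₚ.+-identityʳ n)
             (trans (sym (⊛-distribʳ g (F ∘ suc) _ n))
               (⊛-cong {g = g} (λ j → sym (suc-* (+ suc j) (F (suc j)))) (λ _ → refl) n)) ⟩
      Tr (D ^ᴹ suc (suc n)) + returnTraces F g (2 ℕ.+ n) ∎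
      where
      regroup : ∀ a b x z t → a * b + x + (z + t) ≡ t + (1ℤ * a * b + (x + z))
      regroup = solve-∀

    logDerivative : LogDerivative (returnDenominator F) (returnTraces F g)
    logDerivative = logDerivative-returns F g refl g-suc

  -- Vertices are deleted one by one. The q obtained is det (1 - X A), each factor 1 - X F being a
  -- Schur complement.
  traces-isLogDerivative : ∀ {s} (A : SquareMatrix s) → IsLogDerivative (traces A)
  traces-isLogDerivative {zero}  A = _ , logDerivative-cong (λ { zero → refl ; (suc _) → refl }) logDerivative-1
  traces-isLogDerivative {suc s} A with traces-isLogDerivative (Block.D A)
  ... | _ , L = _ , logDerivative-cong (λ n → sym (Block.traces-split A n))
                      (logDerivative-* L (Block.logDerivative A))

  -- Companion matrices

  indicator : ℕ → ℕ → ℤ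
  indicator m n = if m ≡ᵇ n then 1ℤ else 0ℤ

  indicator-∙ : ∀ {s} (φ : Series) {m} → m < s →
                (λ (j : Fin s) → indicator m (toℕ j)) ∙ (λ j → φ (toℕ j)) ≡ φ m
  indicator-∙ {suc s} φ {zero}  _         = trans
    (cong₂ _+_ (*-identityˡ (φ 0)) (∙-zeroˡ {s} (λ j → φ (suc (toℕ j))))) (+-identityʳ (φ 0))
  indicator-∙ {suc s} φ {suc m} (s≤s m<s) = trans (+-identityˡ _) (indicator-∙ (φ ∘ suc) m<s)

  subdiagonal : ∀ s → SquareMatrix s
  subdiagonal s i j = indicator (toℕ i) (suc (toℕ j))

  -- No edge leaves vertex 0, so F = 0, and deleting this vertex gives the subdiagonal matrix of the
  -- next smaller size.
  traces-subdiagonal : ∀ s → traces (subdiagonal s) ≗ λ _ → 0ℤ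
  traces-subdiagonal s       zero    = refl
  traces-subdiagonal zero    (suc n) = refl
  traces-subdiagonal (suc s) (suc n) = trans (traces-split (suc n)) (cong₂ _+_
    (traces-subdiagonal s (suc n))
    (trans (⊛-cong {g = g} (λ j → trans (cong (+ suc j *_) (F≡0 j)) (*-zeroʳ (+ suc j))) (λ _ → refl) n)
           (zero-⊛ g n)))
    where
    open Block (subdiagonal (suc s))
    F≡0 : ∀ j → F j ≡ 0ℤ
    F≡0 zero    = refl
    F≡0 (suc j) = ∙-zeroˡ (act D j v)

  -- Each application moves a basis vector one place on. Past the last place both sides are the zero
  -- vector, as the indicator is taken on natural numbers.
  act-subdiagonal : ∀ s i j →
    act (subdiagonal s) i (λ k → indicator (toℕ k) j) ≗ λ k → indicator (toℕ k) (i ℕ.+ j)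
  act-subdiagonal s zero    j k = refl
  act-subdiagonal s (suc i) j k = begin
    act (subdiagonal s) i (subdiagonal s ·ᵥ (λ k → indicator (toℕ k) j)) k
      ≡⟨ act-cong (subdiagonal s) i (shift s) k ⟩
    act (subdiagonal s) i (λ k → indicator (toℕ k) (suc j)) k
      ≡⟨ act-subdiagonal s i (suc j) k ⟩
    indicator (toℕ k) (i ℕ.+ suc j)
      ≡⟨ cong (indicator (toℕ k)) (ℕₚ.+-suc i j) ⟩
    indicator (toℕ k) (suc i ℕ.+ j) ∎
    where
    shift : ∀ s → subdiagonal s ·ᵥ (λ k → indicator (toℕ k) j) ≗ λ k → indicator (toℕ k) (suc j)
    shift (suc s) zero    = ∙-zeroˡ {suc s} (λ k → indicator (toℕ k) j)
    shift (suc s) (suc k) = indicator-∙ {suc s} (λ l → indicator l j) (ℕₚ.m<n⇒m<1+n (toℕ<n k))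

  -- From vertex 0 an edge of weight - q (j + 1) leads to vertex j, and edges of weight 1 lead back
  -- one vertex at a time. So for each length j + 1 ≤ s + 1 there is one first return, and 1 - X F
  -- agrees with q.
  companion : ∀ s → Series → SquareMatrix (suc s)
  companion s q zero    j = - q (suc (toℕ j))
  companion s q (suc i) j = indicator (toℕ i) (toℕ j)

  -- Deleting vertex 0 leaves the subdiagonal matrix, which has zero traces, so only the return term
  -- remains. Its denominator agrees with q up to degree s + 1, and `logDerivative-local` carries
  -- this over to the traces.
  traces-companion : ∀ s {q T} → LogDerivative q T → traces (companion s q) ≗[ suc s ] T
  traces-companion s {q} {T} L = logDerivative-local (suc s)
    (logDerivative-cong (λ n → sym (traces-returns n)) logDerivative) L q-agrees
    where
    open Block (companion s q)
    traces-returns : traces (companion s q) ≗ returnTraces F g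
    traces-returns n = trans (traces-split n)
      (trans (cong (_+ returnTraces F g n) (traces-subdiagonal s n)) (+-identityˡ _))
    F-companion : ∀ j → j ≤ s → - F j ≡ q (suc j)
    F-companion zero    _   = neg-involutive (q 1)
    F-companion (suc j) j<s = begin
      - (w ∙ act D j v)
        ≡⟨ cong -_ (∙-cong {x = w} (λ _ → refl) (λ k →
             trans (act-subdiagonal s j 0 k) (cong (indicator (toℕ k)) (ℕₚ.+-identityʳ j)))) ⟩
      - (w ∙ (λ k → indicator (toℕ k) j))
        ≡⟨ cong -_ (∙-comm w _) ⟩
      - ((λ k → indicator (toℕ k) j) ∙ w)
        ≡⟨ cong -_ (∙-cong {z = w} (λ k → indicator-sym (toℕ k) j) (λ _ → refl)) ⟩
      - ((λ k → indicator j (toℕ k)) ∙ w)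
        ≡⟨ cong -_ (indicator-∙ (λ k → - q (2 ℕ.+ k)) j<s) ⟩
      - - q (2 ℕ.+ j)
        ≡⟨ neg-involutive _ ⟩
      q (2 ℕ.+ j) ∎
      where
      indicator-sym : ∀ m n → indicator m n ≡ indicator n m
      indicator-sym zero    zero    = refl
      indicator-sym zero    (suc n) = refl
      indicator-sym (suc m) zero    = refl
      indicator-sym (suc m) (suc n) = indicator-sym m n
    q-agrees : returnDenominator F ≗[ suc s ] q
    q-agrees zero    _         = sym (LogDerivative.q₀≡1 L)
    q-agrees (suc j) (s≤s j≤s) = F-companion j j≤s

-- The equivalence between traces and congruences

open import Data.Integer.Base using (ℤ; 0ℤ)
open import Data.Nat.Base using (ℕ; zero; suc; _*_; _^_; _/_; _≤_; s≤s; z≤n; NonZero; >-nonZero⁻¹)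
open import Data.Nat.Coprimality using (gcd≡1⇒coprime; coprime⇒gcd≡1; 0-coprimeTo-m⇒m≡1)
open import Data.Nat.DivMod using (m*n/n≡m)
open import Data.Nat.GCD using (gcd)
open import Data.Nat.Primality using (Prime; prime⇒nonZero; ¬prime[1])
open import Data.Nat.Properties using (*-assoc; *-comm; ≤-trans; *-monoʳ-≤; m≤n*m; m*n≢0; m^n≢0)
open import Data.Product using (Σ-syntax; ∃; _×_; _,_)
open import Function.Bundles using (_⇔_; mk⇔)
open import Relation.Binary.PropositionalEquality using (_≡_; refl; sym; trans; cong; subst; subst₂)
open import Relation.Nullary using (contradiction)
open import Defs
open PowerSeries using (Series; _≗[_]_)
open GaussCongruences using (Gauss; IsLogDerivative; logDerivative⇒gauss; gauss⇒logDerivative)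
open MatrixTraces using (traces; traces-isLogDerivative; companion; traces-companion)

-- The congruences do not involve b 0, whereas logarithmic derivatives have no
-- constant term.
withoutConstant : Series → Series
withoutConstant b zero    = 0ℤ
withoutConstant b (suc n) = b (suc n)

withoutConstant-nonZero : ∀ b n .{{_ : NonZero n}} → withoutConstant b n ≡ b n
withoutConstant-nonZero b (suc n) = refl

m*p^[1+k]/p : ∀ m p k .{{_ : NonZero p}} → (m * p ^ suc k) / p ≡ m * p ^ k
m*p^[1+k]/p m p k = trans
  (cong (_/ p) (trans (cong (m *_) (*-comm p (p ^ k))) (sym (*-assoc m (p ^ k) p))))
  (m*n/n≡m (m * p ^ k) p)

theorem13 : ∀ (r : ℕ) → 1 ≤ r → (b : ℕ → ℤ) →
    (Σ[ f ∈ SquareMatrix r ] (∀ (i : ℕ) → 1 ≤ i → i ≤ r → b i ≡ Tr (f ^ᴹ i)))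
    ⇔
    (∀ (n : ℕ) → 1 ≤ n → n ≤ r →
    ∀ (p k m : ℕ) (p-prime : Prime p) → 1 ≤ k → 1 ≤ m →
    n ≡ m * p ^ k → gcd m p ≡ 1 →
    b n ≡ b ((n / p) {{prime⇒nonZero p-prime}}) [mod p ^ k ])
theorem13 (suc s) _ b = mk⇔ necessary sufficient
  where
  r = suc s

  necessary : Σ[ f ∈ SquareMatrix r ] (∀ i → 1 ≤ i → i ≤ r → b i ≡ Tr (f ^ᴹ i)) →
    ∀ n → 1 ≤ n → n ≤ r → ∀ p k m (p-prime : Prime p) → 1 ≤ k → 1 ≤ m →
    n ≡ m * p ^ k → gcd m p ≡ 1 → b n ≡ b ((n / p) {{prime⇒nonZero p-prime}}) [mod p ^ k ]
  necessary (f , b≡Tr) _ _ n≤r p (suc k) m@(suc _) p-prime _ _ refl gcd≡1 =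
    subst (λ n/p → b (m * p ^ suc k) ≡ b n/p [mod p ^ suc k ]) (sym (m*p^[1+k]/p m p k))
      (subst₂ (λ x y → x ≡ y [mod p ^ suc k ])
        (traces≡b (m * p ^ suc k) {{m*n≢0 m (p ^ suc k) {{_}} {{m^n≢0 p (suc k)}}}} n≤r)
        (traces≡b (m * p ^ k) {{m*n≢0 m (p ^ k) {{_}} {{m^n≢0 p k}}}}
          (≤-trans (*-monoʳ-≤ m (m≤n*m (p ^ k) p)) n≤r))
        (logDerivative⇒gauss (traces-isLogDerivative f) r p k m p-prime (gcd≡1⇒coprime gcd≡1) n≤r))
    where
    instance _ = prime⇒nonZero p-prime
    -- Degree 0 is excluded, as b 0 is arbitrary there. Both indices m p^(k+1) and m p^k are
    -- positive because m is.
    traces≡b : ∀ i .{{_ : NonZero i}} → i ≤ r → traces f i ≡ b i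
    traces≡b (suc i) i<r = sym (b≡Tr (suc i) (s≤s z≤n) i<r)

  sufficient : (∀ n → 1 ≤ n → n ≤ r → ∀ p k m (p-prime : Prime p) → 1 ≤ k → 1 ≤ m →
    n ≡ m * p ^ k → gcd m p ≡ 1 → b n ≡ b ((n / p) {{prime⇒nonZero p-prime}}) [mod p ^ k ]) →
    Σ[ f ∈ SquareMatrix r ] (∀ i → 1 ≤ i → i ≤ r → b i ≡ Tr (f ^ᴹ i))
  sufficient congruences = realise (gauss⇒logDerivative r gauss refl)
    where
    realise : ∃ (λ T → IsLogDerivative T × withoutConstant b ≗[ r ] T) →
      Σ[ f ∈ SquareMatrix r ] (∀ i → 1 ≤ i → i ≤ r → b i ≡ Tr (f ^ᴹ i))
    -- The companion matrix of size s + 1 = r has the coefficients of T as traces up to degree r,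
    -- where T agrees with b in positive degrees.
    realise (T , (q , L) , b≗T) = companion s q , λ { (suc i) _ i<r →
      trans (b≗T (suc i) i<r) (sym (traces-companion s L (suc i) i<r)) }
    gauss : Gauss r (withoutConstant b)
    -- `Gauss` admits m = 0, but coprimality of 0 and p forces p = 1.
    gauss p k zero p-prime 0⊥p _ =
      contradiction (subst Prime (0-coprimeTo-m⇒m≡1 0⊥p) p-prime) ¬prime[1]
    gauss p k m@(suc _) p-prime m⊥p ≤r = subst₂ (λ x y → x ≡ y [mod p ^ suc k ])
      (sym (withoutConstant-nonZero b n))
      (sym (trans (withoutConstant-nonZero b (m * p ^ k)) (cong b (sym (m*p^[1+k]/p m p k)))))
      (congruences n (>-nonZero⁻¹ n) ≤r p (suc k) m p-prime (s≤s z≤n) (s≤s z≤n) refl (coprime⇒gcd≡1 m⊥p))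
      where
      n = m * p ^ suc k
      instance
        p≢0 = prime⇒nonZero p-prime
        n≢0 : NonZero n
        n≢0 = m*n≢0 m (p ^ suc k) {{_}} {{m^n≢0 p (suc k)}}
        n/p≢0 : NonZero (m * p ^ k)
        n/p≢0 = m*n≢0 m (p ^ k) {{_}} {{m^n≢0 p k}}
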